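{- There is an absolute constant $C>0$ such that for all integers $d\geq 2$ and $\ell\geq 2$, every $S'_d$-free graph that does not contain $K_{\ell,\ell}$ as a (not necessarily induced) subgraph has degeneracy at most $C\,\ell^{2d-1}$.
   Context: All graphs are finite, simple and undirected. For $d\geq 2$, $S'_d$ denotes the $1$-subdivision of the star $K_{1,d}$, i.e., the graph obtained from a star with $d$ leaves by subdividing each edge exactly once (so $S'_d$ has $2d+1$ vertices). A graph $G$ is $H$-free if it has no induced subgraph isomorphic to $H$. $K_{\ell,\ell}$ is the complete bipartite graph with $\ell$ vertices on each side. A graph is $k$-degenerate if every (nonempty) induced subgraph contains a vertex of degree at most $k$ in that subgraph; the degeneracy of $G$ is the minimum $k\geq 0$ for which $G$ is $k$-degenerate. -}

module Defs where

open import Data.Empty using (⊥)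
open import Data.Fin using (Fin; _≟_)
open import Data.Fin.Properties using (any?)
open import Data.Fin.Subset using (Subset; _∈_; _∩_; ∣_∣; Nonempty)
open import Data.Fin.Subset.Properties using (_∈?_; nonempty?; anySubset?; ∣p∣≤n)
open import Data.Nat using (ℕ; zero; suc; _≤_; _≤?_; z≤n; s≤s)
open import Data.Product using (∃; _×_; _,_; proj₁)
open import Data.Sum using (_⊎_; inj₁; inj₂)
open import Data.Unit using (⊤; tt)
open import Data.Vec using (tabulate)
open import Function.Base using (_∘_)
open import Function.Bundles using (_↔_; _⇔_; Inverse)
open import Function.Definitions using (Injective)
open import Level using (0ℓ)
open import Relation.Binary using (Rel; Symmetric; Decidable)
open import Relation.Binary.PropositionalEquality using (_≡_; sym)
open import Relation.Nullary
  using (¬_; Dec; yes; no; does; ¬?; contradiction; _×-dec_; _→-dec_)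
open import Relation.Nullary.Decidable using (map′; decidable-stable)

-- Simple undirected graphs with vertex type V.  Adjacency is decidable, so
-- that for finite V this is the classical notion.
record Graph (V : Set) : Set₁ where
  field
    _~_    : Rel V 0ℓ
    ~-sym  : Symmetric _~_
    ~-irr  : ∀ {v} → ¬ (v ~ v)
    _~?_   : Decidable _~_

record _≅_ {V W : Set} (G : Graph V) (H : Graph W) : Set where
  private
    module G = Graph G
    module H = Graph H
  field
    bijection : V ↔ W
  open Inverse bijection public using (to; from)
  field
    preserves : ∀ u v → (u G.~ v) ⇔ (to u H.~ to v)

-- Membership in a Subset is proof-irrelevant, so the vertices of the induced
-- subgraph are exactly the elements of S.
induced : ∀ {n} → Graph (Fin n) → (S : Subset n) → Graph (∃ λ v → v ∈ S)
induced G S = record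
  { _~_   = λ u v → proj₁ u ~ proj₁ v
  ; ~-sym = ~-sym
  ; ~-irr = ~-irr
  ; _~?_  = λ u v → proj₁ u ~? proj₁ v
  }
  where open Graph G

_-Free_ : ∀ {W n} → Graph W → Graph (Fin n) → Set
H -Free G = ¬ (∃ λ S → induced G S ≅ H)

-- G has a (not necessarily induced) subgraph isomorphic to H: the subgraph is
-- the image of an injective homomorphism.
record _ContainsSubgraph_ {V W : Set} (G : Graph V) (H : Graph W) : Set where
  private
    module G = Graph G
    module H = Graph H
  field
    embed     : W → V
    injective : Injective _≡_ _≡_ embed
    preserves : ∀ {u v} → u H.~ v → embed u G.~ embed v

-- The edge of the star from the centre to leaf i is subdivided by mid i.
data StarVertex (d : ℕ) : Set where
  centre : StarVertex d
  mid    : Fin d → StarVertex d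
  leaf   : Fin d → StarVertex d

subdividedStar : (d : ℕ) → Graph (StarVertex d)
subdividedStar d = record
  { _~_   = Adj
  ; ~-sym = λ {u} {v} → Adj-sym u v
  ; ~-irr = λ {v} → Adj-irr v
  ; _~?_  = Adj?
  }
  where
  Adj : Rel (StarVertex d) 0ℓ
  Adj centre   (mid _)  = ⊤
  Adj (mid _)  centre   = ⊤
  Adj (mid i)  (leaf j) = i ≡ j
  Adj (leaf i) (mid j)  = i ≡ j
  Adj centre   centre   = ⊥
  Adj centre   (leaf _) = ⊥
  Adj (leaf _) centre   = ⊥
  Adj (mid _)  (mid _)  = ⊥
  Adj (leaf _) (leaf _) = ⊥

  Adj-sym : ∀ u v → Adj u v → Adj v u
  Adj-sym centre   (mid _)  _ = tt
  Adj-sym (mid _)  centre   _ = tt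
  Adj-sym (mid _)  (leaf _) p = sym p
  Adj-sym (leaf _) (mid _)  p = sym p

  Adj-irr : ∀ v → ¬ Adj v v
  Adj-irr centre   ()
  Adj-irr (mid _)  ()
  Adj-irr (leaf _) ()

  Adj? : Decidable Adj
  Adj? centre   (mid _)  = yes tt
  Adj? (mid _)  centre   = yes tt
  Adj? (mid i)  (leaf j) = i ≟ j
  Adj? (leaf i) (mid j)  = i ≟ j
  Adj? centre   centre   = no λ ()
  Adj? centre   (leaf _) = no λ ()
  Adj? (leaf _) centre   = no λ ()
  Adj? (mid _)  (mid _)  = no λ ()
  Adj? (leaf _) (leaf _) = no λ ()

completeBipartite : (a b : ℕ) → Graph (Fin a ⊎ Fin b)
completeBipartite a b = record
  { _~_   = Adj
  ; ~-sym = λ {u} {v} → Adj-sym u v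
  ; ~-irr = λ {v} → Adj-irr v
  ; _~?_  = Adj?
  }
  where
  Adj : Rel (Fin a ⊎ Fin b) 0ℓ
  Adj (inj₁ _) (inj₂ _) = ⊤
  Adj (inj₂ _) (inj₁ _) = ⊤
  Adj (inj₁ _) (inj₁ _) = ⊥
  Adj (inj₂ _) (inj₂ _) = ⊥

  Adj-sym : ∀ u v → Adj u v → Adj v u
  Adj-sym (inj₁ _) (inj₂ _) _ = tt
  Adj-sym (inj₂ _) (inj₁ _) _ = tt

  Adj-irr : ∀ v → ¬ Adj v v
  Adj-irr (inj₁ _) ()
  Adj-irr (inj₂ _) ()

  Adj? : Decidable Adj
  Adj? (inj₁ _) (inj₂ _) = yes tt
  Adj? (inj₂ _) (inj₁ _) = yes tt
  Adj? (inj₁ _) (inj₁ _) = no λ ()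
  Adj? (inj₂ _) (inj₂ _) = no λ ()

module _ {n : ℕ} (G : Graph (Fin n)) where
  open Graph G

  neighbours : Fin n → Subset n
  neighbours v = tabulate (λ w → does (v ~? w))

  -- For v ∈ S, the degree of v in the subgraph induced by S.
  degreeIn : Subset n → Fin n → ℕ
  degreeIn S v = ∣ neighbours v ∩ S ∣

  LowDegreeVertex : ℕ → Subset n → Set
  LowDegreeVertex k S = ∃ λ v → v ∈ S × degreeIn S v ≤ k

  Degenerate : ℕ → Set
  Degenerate k = ∀ (S : Subset n) → Nonempty S → LowDegreeVertex k S

  degenerate? : ∀ k → Dec (Degenerate k)
  degenerate? k = map′
    (λ none S → decidable-stable (good? S) (λ bad → none (S , bad)))
    (λ all (S , bad) → bad (all S))
    (¬? (anySubset? (λ S → ¬? (good? S))))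
    where
    good? : ∀ S → Dec (Nonempty S → LowDegreeVertex k S)
    good? S = nonempty? S →-dec any? (λ v → v ∈? S ×-dec degreeIn S v ≤? k)

  degenerate-n : Degenerate n
  degenerate-n S (v , v∈S) = v , v∈S , ∣p∣≤n (neighbours v ∩ S)

IsMinimum : (ℕ → Set) → ℕ → Set
IsMinimum P k = P k × (∀ j → P j → k ≤ j)

minimum : {P : ℕ → Set} → (∀ k → Dec (P k)) → ∀ m → P m → ∃ (IsMinimum P)
minimum P? zero    p = zero , p , λ _ _ → z≤n
minimum {P} P? (suc m) p with P? zero
... | yes p₀ = zero , p₀ , λ _ _ → z≤n
... | no ¬p₀ with minimum {P ∘ suc} (P? ∘ suc) m p
...   | k , pₖ , least = suc k , pₖ , λ
        { zero    p₀ → contradiction p₀ ¬p₀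
        ; (suc j) pⱼ → s≤s (least j pⱼ)
        }

minimumDegenerate : ∀ {n} (G : Graph (Fin n)) → ∃ (IsMinimum (Degenerate G))
minimumDegenerate {n} G = minimum (degenerate? G) n (degenerate-n G)

degeneracy : ∀ {n} → Graph (Fin n) → ℕ
degeneracy G = proj₁ (minimumDegenerate G)

{-# OPTIONS --safe #-}

-- If ℓ·y ≤ |A|, then fewer than ℓ vertices have fewer than y nonneighbours in A,
-- since ℓ of them would have ℓ common neighbours in A.  So making A avoid the
-- neighbourhood of a generic vertex costs a factor ℓ.  Let v have minimum degree
-- in an induced subgraph, of order ℓ^(2d−1).  Almost every neighbour m of v is
-- nonadjacent to at least ℓ^(2d−2) neighbours of v, and by minimality m then has
-- as many neighbours L m outside N(v).  Choose d independent such m; avoiding the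
-- neighbours of the d−1 others leaves ℓ^(d−1) vertices in each L m.  Greedily
-- choosing independent leaves from these d lists costs the last ℓ^(d−1).
module Submission where

open import Defs
open import Algebra.Properties.CommutativeSemigroup using (x∙yz≈y∙xz)
open import Data.Bool using (true; false)
open import Data.Fin using (Fin; zero; suc; inject≤)
open import Data.Fin.Properties
  using (any?; inject≤-injective) renaming (_≟_ to _≟ᶠ_; suc-injective to suc-injectiveᶠ)
open import Data.Fin.Subset using (Subset; _∩_; ∣_∣; inside; outside)
import Data.Fin.Subset as Subset
open import Data.List using (List; []; _∷_; length; filter; lookup; map; take)
open import Data.List.Extrema.Nat using (argmin; argmin-sel; f[argmin]≤f[xs])
open import Data.List.Membership.Propositional using (_∈_; find)
open import Data.List.Membership.Propositional.Properties
  using (∈-filter⁻; ∈-lookup; ∈-map⁺; ∈-map⁻)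
open import Data.List.Properties
  using (length-filter; length-take; filter-all; filter-none)
open import Data.List.Relation.Unary.All as All using (All; []; _∷_; all?)
open import Data.List.Relation.Unary.All.Properties
  using (¬All⇒Any¬; all-filter) renaming (take⁺ to All-take⁺; map⁺ to All-map⁺)
open import Data.List.Relation.Unary.Any using (here; there)
open import Data.List.Relation.Unary.AllPairs using ([]; _∷_)
open import Data.List.Relation.Unary.Unique.Propositional using (Unique)
import Data.List.Relation.Unary.Unique.Propositional.Properties as Unique
open import Data.Nat
open import Data.Nat.Properties
open import Data.Nat.Tactic.RingSolver using (solve-∀)
open import Data.Product using (∃; _×_; _,_; proj₁; proj₂)
open import Data.Sum using (_⊎_; inj₁; inj₂; [_,_]′)
open import Data.Unit using (tt)
open import Data.Vec using (Vec; tabulate)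
import Data.Vec as Vec
open import Data.Vec.Properties using ([]=⇒lookup; lookup⇒[]=; lookup∘tabulate)
open import Level using (0ℓ)
open import Function using (_⇔_; Injective; _∘_; id; mk⇔; mk↔ₛ′; module Equivalence)
open import Relation.Binary.PropositionalEquality
open import Relation.Nullary
  using (¬_; Dec; yes; no; does; ¬?; contradiction; _⊎-dec_)
open import Relation.Nullary.Decidable using (decidable-stable; dec-true; map′)
open import Relation.Unary using (Pred; Decidable; _⊆_; _∪_)

private variable
  A B : Set

-- Counting in lists.

count : {P : Pred A 0ℓ} → Decidable P → List A → ℕ
count P? xs = length (filter P? xs)

count-cover : {P Q R : Pred A 0ℓ} (P? : Decidable P) (Q? : Decidable Q) (R? : Decidable R) →
              P ⊆ Q ∪ R → ∀ xs → count P? xs ≤ count Q? xs + count R? xs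
count-cover P? Q? R? cover [] = z≤n
count-cover P? Q? R? cover (x ∷ xs)
  with ih ← count-cover P? Q? R? cover xs | P? x | Q? x | R? x
... | no _  | no _  | no _  = ih
... | no _  | no _  | yes _ = ≤-trans ih (+-monoʳ-≤ _ (n≤1+n _))
... | no _  | yes _ | no _  = m≤n⇒m≤1+n ih
... | no _  | yes _ | yes _ = m≤n⇒m≤1+n (≤-trans ih (+-monoʳ-≤ _ (n≤1+n _)))
... | yes p | no ¬q | no ¬r = contradiction (cover p) [ ¬q , ¬r ]′
... | yes _ | no _  | yes _ = ≤-trans (s≤s ih) (≤-reflexive (sym (+-suc _ _)))
... | yes _ | yes _ | no _  = s≤s ih
... | yes _ | yes _ | yes _ = s≤s (≤-trans ih (+-monoʳ-≤ _ (n≤1+n _)))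

count-split : {P : Pred A 0ℓ} (P? : Decidable P) (xs : List A) →
              count P? xs + count (¬? ∘ P?) xs ≡ length xs
count-split P? [] = refl
count-split P? (x ∷ xs) with ih ← count-split P? xs | P? x
... | yes _ = cong suc ih
... | no _  = trans (+-suc _ _) (cong suc ih)

count-filter-comm : {P Q : Pred A 0ℓ} (P? : Decidable P) (Q? : Decidable Q) (xs : List A) →
                    count P? (filter Q? xs) ≡ count Q? (filter P? xs)
count-filter-comm P? Q? [] = refl
count-filter-comm P? Q? (x ∷ xs)
  with ih ← count-filter-comm P? Q? xs | P? x in p | Q? x in q
... | yes _ | yes _ rewrite p | q = cong suc ih
... | yes _ | no _  rewrite q = ih
... | no _  | yes _ rewrite p = ih
... | no _  | no _  = ih

count-filter-≤ : {P Q : Pred A 0ℓ} (P? : Decidable P) (Q? : Decidable Q) (xs : List A) →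
                 count P? (filter Q? xs) ≤ count P? xs
count-filter-≤ P? Q? xs =
  subst (_≤ count P? xs) (sym (count-filter-comm P? Q? xs)) (length-filter Q? (filter P? xs))

count-any : ∀ s {r} {P : Fin s → Pred A 0ℓ} (P? : ∀ i → Decidable (P i)) (xs : List A) →
            (∀ i → count (P? i) xs ≤ r) →
            count (λ x → any? (λ i → P? i x)) xs ≤ s * r
count-any zero P? xs few = ≤-reflexive
  (cong length (filter-none (λ x → any? (λ i → P? i x)) (All.universal (λ _ ()) xs)))
count-any (suc s) P? xs few = ≤-trans
  (count-cover (λ x → any? (λ i → P? i x)) (P? zero) (λ x → any? (λ i → P? (suc i) x))
    (λ { (zero , p) → inj₁ p ; (suc i , p) → inj₂ (i , p) }) xs)
  (+-mono-≤ (few zero) (count-any s (P? ∘ suc) xs (few ∘ suc)))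

count<length⇒∃¬ : {P : Pred A 0ℓ} (P? : Decidable P) (xs : List A) →
                  count P? xs < length xs → ∃ λ x → x ∈ xs × ¬ P x
count<length⇒∃¬ P? xs lt = find (¬All⇒Any¬ P? xs λ all →
  <-irrefl (cong length (filter-all P? all)) lt)

lookup-injective : {xs : List A} → Unique xs →
                   ∀ i j → lookup xs i ≡ lookup xs j → i ≡ j
lookup-injective (_ ∷ _)    zero    zero    _  = refl
lookup-injective (x≢ ∷ _)   zero    (suc j) eq = contradiction eq (All.lookup x≢ (∈-lookup j))
lookup-injective (x≢ ∷ _)   (suc i) zero    eq = contradiction (sym eq) (All.lookup x≢ (∈-lookup i))
lookup-injective (_ ∷ uniq) (suc i) (suc j) eq = cong suc (lookup-injective uniq i j eq)

-- Double counting of related pairs.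

module DoubleCounting {R : A → B → Set} (R? : ∀ a b → Dec (R a b)) where

  edges : List A → List B → ℕ
  edges as []       = 0
  edges as (b ∷ bs) = count (λ a → R? a b) as + edges as bs

  edges-[] : ∀ bs → edges [] bs ≡ 0
  edges-[] []       = refl
  edges-[] (_ ∷ bs) = edges-[] bs

  -- This exchanges the order of summation: `edges` sums over the second list, and here the
  -- contribution of one element of the first list is split off.
  edges-∷ : ∀ a as bs → edges (a ∷ as) bs ≡ count (R? a) bs + edges as bs
  edges-∷ a as [] = refl
  edges-∷ a as (b ∷ bs) with ih ← edges-∷ a as bs | R? a b
  ... | no _  = trans (cong (deg +_) ih) (x∙yz≈y∙xz +-commutativeSemigroup deg (count (R? a) bs) _)
    where deg = count (λ a → R? a b) as
  ... | yes _ = cong suc (trans (cong (deg +_) ih) (x∙yz≈y∙xz +-commutativeSemigroup deg (count (R? a) bs) _))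
    where deg = count (λ a → R? a b) as

  edges-≤ : ∀ {k as bs} → All (λ a → count (R? a) bs ≤ k) as →
            edges as bs ≤ length as * k
  edges-≤ {bs = bs} [] = ≤-reflexive (edges-[] bs)
  edges-≤ {k} {a ∷ as} {bs} (h ∷ hs) =
    subst (_≤ k + length as * k) (sym (edges-∷ a as bs)) (+-mono-≤ h (edges-≤ {as = as} {bs} hs))

  edges-≥ : ∀ {k as bs} → All (λ b → k ≤ count (λ a → R? a b) as) bs →
            length bs * k ≤ edges as bs
  edges-≥ []       = z≤n
  edges-≥ (h ∷ hs) = +-mono-≤ h (edges-≥ hs)

  double-count : ∀ {k K as bs} → All (λ a → count (R? a) bs ≤ k) as →
                 All (λ b → K ≤ count (λ a → R? a b) as) bs →
                 length bs * K ≤ length as * k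
  double-count {as = as} {bs} few many = ≤-trans (edges-≥ {as = as} {bs} many) (edges-≤ {as = as} {bs} few)

-- Markov's inequality: there are at most `k * length xs` related pairs, and every popular element
-- takes up `2 * k` of them.
few-popular : {R : A → A → Set} (R? : ∀ a b → Dec (R a b)) → ∀ k .{{_ : NonZero k}} xs →
              All (λ a → count (R? a) xs ≤ k) xs →
              2 * count (λ b → 2 * k ≤? count (λ a → R? a b) xs) xs ≤ length xs
few-popular R? k xs few = *-cancelʳ-≤ _ _ k (begin
  2 * h * k         ≡⟨ shuffle h k ⟩
  h * (2 * k)       ≤⟨ double-count
                         (All.map (≤-trans (count-filter-≤ _ popular? xs)) few)
                         (all-filter popular? xs) ⟩
  length xs * k     ∎)
  where
  open ≤-Reasoning
  open DoubleCounting R?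
  popular? = λ b → 2 * k ≤? count (λ a → R? a b) xs
  h = count popular? xs
  shuffle : ∀ h k → 2 * h * k ≡ h * (2 * k)
  shuffle = solve-∀

-- Size bounds and their arithmetic.

nonempty : {xs : List A} → 1 ≤ length xs → ∃ (_∈ xs)
nonempty {xs = x ∷ _} _ = x , here refl

-- An explicit list witnesses the bound, because vertices will come from an arbitrary type, where
-- there is no list of all of them to count in. `transversal` then picks from this list.
AtLeast : ℕ → (A → Set) → Set
AtLeast k P = ∃ λ xs → Unique xs × k ≤ length xs × All P xs

weaken : ∀ {k} {P Q : Pred A 0ℓ} → P ⊆ Q → AtLeast k P → AtLeast k Q
weaken P⊆Q (xs , unique , large , all) = xs , unique , large , All.map P⊆Q all

-- Bernoulli's inequality for `1 + pred ℓ`. If each of `k` conditions excludes at most `pred ℓ`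
-- elements, a list of length `ℓ ^ k` keeps one.
bernoulli : ∀ ℓ .{{_ : NonZero ℓ}} k → k * pred ℓ < ℓ ^ k
bernoulli ℓ       zero    = ≤-refl
bernoulli (suc r) (suc k) = begin
  1 + (r + k * r)             ≤⟨ m≤m+n _ _ ⟩
  1 + (r + k * r) + r * k * r ≡⟨ expand r k ⟩
  suc r * (1 + k * r)         ≤⟨ *-monoʳ-≤ (suc r) (bernoulli (suc r) k) ⟩
  suc r * suc r ^ k           ∎
  where
  open ≤-Reasoning
  expand : ∀ r k → 1 + (r + k * r) + r * k * r ≡ suc r * (1 + k * r)
  expand = solve-∀

-- The origin of the constant: the factor `4 * d` is at most `8 * ℓ ^ e` because
-- `2 + e ≤ 2 * ℓ ^ e`, and the summand `pred ℓ` fits into a ninth copy. The exponent `suc (d + e)`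
-- is 2d - 1.
degree-bound : ∀ {ℓ} → 2 ≤ ℓ → ∀ e → let d = 2 + e in
               2 * (d + d) * ℓ ^ suc d + pred ℓ ≤ 9 * ℓ ^ suc (d + e)
degree-bound {ℓ} 2≤ℓ e = begin
  2 * (2 + e + (2 + e)) * x + pred ℓ  ≡⟨ cong (_+ pred ℓ) (regroup₁ e x) ⟩
  4 * (2 + e) * x + pred ℓ            ≤⟨ +-mono-≤ (*-monoˡ-≤ x (*-monoʳ-≤ 4 linear)) small ⟩
  4 * (2 * y) * x + x * y             ≡⟨ regroup₂ y x ⟩
  9 * (x * y)                         ≡⟨ cong (9 *_) (^-distribˡ-+-* ℓ (3 + e) e) ⟨
  9 * ℓ ^ (3 + e + e)                 ∎
  where
  open ≤-Reasoning
  instance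
    ℓ≢0 : NonZero ℓ
    ℓ≢0 = >-nonZero (<⇒≤ 2≤ℓ)
    pred≢0 : NonZero (pred ℓ)
    pred≢0 = >-nonZero (<⇒≤pred 2≤ℓ)
  x = ℓ ^ (3 + e)
  y = ℓ ^ e
  regroup₁ : ∀ e x → 2 * (2 + e + (2 + e)) * x ≡ 4 * (2 + e) * x
  regroup₁ = solve-∀
  regroup₂ : ∀ x y → 4 * (2 * x) * y + y * x ≡ 9 * (y * x)
  regroup₂ = solve-∀
  linear : 2 + e ≤ 2 * y
  linear = begin
    2 + e                ≤⟨ +-monoʳ-≤ 2 (m≤m*n e (pred ℓ)) ⟩
    2 + e * pred ℓ       ≤⟨ +-monoʳ-≤ 2 (m≤m+n (e * pred ℓ) _) ⟩
    2 + 2 * (e * pred ℓ) ≡⟨ *-distribˡ-+ 2 1 (e * pred ℓ) ⟨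
    2 * (1 + e * pred ℓ) ≤⟨ *-monoʳ-≤ 2 (bernoulli ℓ e) ⟩
    2 * y                ∎
  small : pred ℓ ≤ x * y
  small = begin
    pred ℓ  ≤⟨ pred[n]≤n ⟩
    ℓ       ≤⟨ m≤m*n ℓ (ℓ ^ (2 + e)) {{m^n≢0 ℓ (2 + e)}} ⟩
    x       ≤⟨ m≤m*n x y {{m^n≢0 ℓ e}} ⟩
    x * y   ∎

-- Avoiding neighbourhoods in a biclique-free graph.

module BicliqueFree {V : Set} (G : Graph V) (ℓ : ℕ) .{{_ : NonZero ℓ}}
  (K-free : ¬ (G ContainsSubgraph completeBipartite ℓ ℓ)) where

  open Graph G

  private
    r : ℕ
    r = pred ℓ

  infixl 6 _∖N_

  -- A vertex `b` of the list stays in it, being no neighbour of itself. Distinctness of the chosen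
  -- vertices is not tracked; `star-twin-free` provides it in the end.
  _∖N_ : List V → V → List V
  xs ∖N b = filter (λ a → ¬? (b ~? a)) xs

  Cramped : List V → ℕ → V → Set
  Cramped xs y b = length (xs ∖N b) < y

  cramped? : ∀ xs y b → Dec (Cramped xs y b)
  cramped? xs y b = length (xs ∖N b) <? y

  no-biclique : ∀ {xs ys} → Unique xs → Unique ys → All (λ b → All (b ~_) ys) xs →
                ℓ ≤ length xs → ¬ ℓ ≤ length ys
  no-biclique {xs} {ys} ux uy adj lx ly = K-free record
    { embed     = λ { (inj₁ i) → lookup xs (inject≤ i lx)
                    ; (inj₂ j) → lookup ys (inject≤ j ly) }
    ; injective = λ
      { {inj₁ i} {inj₁ j} eq → cong inj₁ (inject≤-injective lx lx i j (lookup-injective ux _ _ eq))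
      ; {inj₂ i} {inj₂ j} eq → cong inj₂ (inject≤-injective ly ly i j (lookup-injective uy _ _ eq))
      -- The two sides are disjoint, as a shared vertex would be adjacent to itself.
      ; {inj₁ i} {inj₂ j} eq → contradiction (subst (_~ _) eq (edge i j)) ~-irr
      ; {inj₂ j} {inj₁ i} eq → contradiction (subst (_~ _) (sym eq) (edge i j)) ~-irr
      }
    ; preserves = λ { {inj₁ i} {inj₂ j} _ → edge i j ; {inj₂ j} {inj₁ i} _ → ~-sym (edge i j) }
    }
    where
    edge : ∀ i j → lookup xs (inject≤ i lx) ~ lookup ys (inject≤ j ly)
    edge i j = All.lookup (All.lookup adj (∈-lookup _)) (∈-lookup _)

  common? : ∀ bs a → Dec (All (_~ a) bs)
  common? bs a = all? (_~? a) bs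

  -- Each cramped vertex removes at most `y` - 1 elements from the common neighbourhood. The summand
  -- `length bs` on the left collects these ones and avoids truncated subtraction.
  common-large : ∀ {y} xs {bs} → All (Cramped xs y) bs →
                 length xs + length bs ≤ count (common? bs) xs + length bs * y
  common-large xs [] = +-monoˡ-≤ 0
    (≤-reflexive (cong length (sym (filter-all (common? []) (All.universal (λ _ → []) xs)))))
  common-large {y} xs {b ∷ bs} (h ∷ hs) = begin
    length xs + suc (length bs)                   ≡⟨ +-suc _ _ ⟩
    suc (length xs + length bs)                   ≤⟨ s≤s (common-large xs hs) ⟩
    suc (count (common? bs) xs + length bs * y)   ≤⟨ s≤s (+-monoˡ-≤ _ (count-cover _ _ _ cover xs)) ⟩
    suc (c + length (xs ∖N b) + length bs * y)    ≡⟨ shuffle c _ _ ⟩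
    c + (suc (length (xs ∖N b)) + length bs * y)  ≤⟨ +-monoʳ-≤ c (+-monoˡ-≤ _ h) ⟩
    c + (y + length bs * y)                       ∎
    where
    open ≤-Reasoning
    c = count (common? (b ∷ bs)) xs
    cover : ∀ {a} → All (_~ a) bs → All (_~ a) (b ∷ bs) ⊎ ¬ b ~ a
    cover {a} all with b ~? a
    ... | yes b~a = inj₁ (b~a ∷ all)
    ... | no  b≁a = inj₂ b≁a
    shuffle : ∀ c x z → suc (c + x + z) ≡ c + (suc x + z)
    shuffle = solve-∀

  -- ℓ cramped vertices would miss at most ℓ (y − 1) elements of xs in total,
  -- leaving ℓ common neighbours.
  few-cramped : ∀ {xs bs y} → Unique xs → Unique bs → ℓ * y ≤ length xs →
                count (cramped? xs y) bs ≤ r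
  few-cramped {xs} {bs} {y} ux ub large = <⇒≤pred (≰⇒> λ many →
    let len : length cs ≡ ℓ
        len = trans (length-take ℓ (filter (cramped? xs y) bs)) (m≤n⇒m⊓n≡m many)
        bound : length xs + ℓ ≤ count (common? cs) xs + ℓ * y
        bound = subst (λ k → length xs + k ≤ count (common? cs) xs + k * y) len
                  (common-large xs (All-take⁺ ℓ (all-filter (cramped? xs y) bs)))
    in no-biclique (Unique.take⁺ ℓ (Unique.filter⁺ (cramped? xs y) ub))
         (Unique.filter⁺ (common? cs) ux)
         (All.tabulate λ b∈cs → All.map (λ all → All.lookup all b∈cs) (all-filter (common? cs) xs))
         (≤-reflexive (sym len))
         (+-cancelʳ-≤ (ℓ * y) _ _ (≤-trans (+-monoʳ-≤ ℓ large)
           (≤-trans (≤-reflexive (+-comm ℓ _)) bound))))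
    where cs = take ℓ (filter (cramped? xs y) bs)

  -- Induction on `p`: each later list is cramped by at most `pred ℓ` vertices of `L zero`, so by
  -- `bernoulli` some `x` there cramps none of them, and avoiding `x` costs one factor `ℓ`. The last
  -- list need only be nonempty, so `suc p` lists cost only `ℓ ^ p`.
  transversal : ∀ p (L : Fin (suc p) → List V) → (∀ i → Unique (L i)) →
                (∀ i → ℓ ^ p ≤ length (L i)) →
                ∃ λ (l : Fin (suc p) → V) → (∀ i → l i ∈ L i) × (∀ i j → ¬ l i ~ l j)
  transversal zero L _ large
    with x , x∈ ← nonempty (large zero)
    = (λ _ → x) , (λ { zero → x∈ }) , λ _ _ → ~-irr
  transversal (suc p) L unique large
    with x , x∈ , ok ← count<length⇒∃¬
           (λ b → any? (λ i → cramped? (L (suc i)) (ℓ ^ p) b)) (L zero)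
           (≤-trans (s≤s (count-any (suc p) (λ i → cramped? (L (suc i)) (ℓ ^ p)) (L zero)
                (λ i → few-cramped (unique (suc i)) (unique zero) (large (suc i)))))
              (≤-trans (bernoulli ℓ (suc p)) (large zero)))
    with l , l∈ , indep ← transversal p (λ i → L (suc i) ∖N x)
           (λ i → Unique.filter⁺ _ (unique (suc i)))
           (λ i → ≮⇒≥ λ cramped → ok (i , cramped))
    = (λ { zero → x ; (suc i) → l i })
    , (λ { zero → x∈ ; (suc i) → proj₁ (∈-filter⁻ _ (l∈ i)) })
    , λ { zero    zero    → ~-irr
        ; zero    (suc j) → x≁l j
        ; (suc i) zero    → x≁l i ∘ ~-sym
        ; (suc i) (suc j) → indep i j }
    where
    x≁l : ∀ i → ¬ x ~ l i
    x≁l i = proj₂ (∈-filter⁻ (λ a → ¬? (x ~? a)) {xs = L (suc i)} (l∈ i))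

  -- Choosing independent middle vertices.

  private
    -- The summands count the candidates that cramp one of the `s` earlier lists, that cramp the
    -- candidate list itself, and that are popular. The popular ones fill at most half of `N`; the
    -- others fit into the remaining half because `2 * suc s * ℓ ≤ N`.
    few-bad : ∀ {s t d h N} → s + suc t ≤ d → 2 * (d + suc t) * ℓ ^ suc (suc t) ≤ N →
              2 * h ≤ N → s * r + (r + h) < N
    few-bad {s} {t} {d} {h} {N} st≤d large few = *-cancelˡ-< 2 _ _ (begin-strict
      2 * (s * r + (r + h))                    ≡⟨ regroup s r h ⟩
      2 * suc s * r + 2 * h                    <⟨ +-mono-<-≤ (*-monoʳ-< (2 * suc s) (≤-reflexive (suc-pred ℓ))) few ⟩
      2 * suc s * ℓ + N                        ≤⟨ +-monoˡ-≤ N (*-mono-≤ (*-monoʳ-≤ 2 s<d+t)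
                                                    (m≤m*n ℓ (ℓ ^ suc t) {{m^n≢0 ℓ (suc t)}})) ⟩
      2 * (d + suc t) * ℓ ^ suc (suc t) + N    ≤⟨ +-monoˡ-≤ N large ⟩
      N + N                                    ≡⟨ cong (N +_) (+-identityʳ N) ⟨
      2 * N                                    ∎)
      where
      open ≤-Reasoning
      regroup : ∀ s r h → 2 * (s * r + (r + h)) ≡ 2 * suc s * r + 2 * h
      regroup = solve-∀
      s<d+t : suc s ≤ d + suc t
      s<d+t = begin
        suc s       ≤⟨ s≤s (m≤m+n s t) ⟩
        suc (s + t) ≡⟨ +-suc s t ⟨
        s + suc t   ≤⟨ st≤d ⟩
        d           ≤⟨ m≤m+n d (suc t) ⟩
        d + suc t   ∎

    -- This explains the coefficient `2 * (d + t)`: the part `2 * d` makes room in `few-bad`, and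
    -- every round adds 2 to pay for deleting up to `2 * ℓ` candidates whose lists get spoiled.
    next-size : ∀ d t → ℓ * (2 * (d + t) * ℓ ^ suc t + 2 * ℓ) ≤ 2 * (d + suc t) * ℓ ^ suc (suc t)
    next-size d t = begin
      ℓ * (2 * (d + t) * ℓ ^ suc t + 2 * ℓ)            ≤⟨ *-monoʳ-≤ ℓ (+-monoʳ-≤ (2 * (d + t) * ℓ ^ suc t)
                                                            (*-monoʳ-≤ 2 (m≤m*n ℓ (ℓ ^ t) {{m^n≢0 ℓ t}}))) ⟩
      ℓ * (2 * (d + t) * ℓ ^ suc t + 2 * ℓ ^ suc t)    ≡⟨ regroup ℓ d t (ℓ ^ suc t) ⟩
      2 * (d + suc t) * ℓ ^ suc (suc t)                ∎
      where
      open ≤-Reasoning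
      regroup : ∀ l d t x → l * (2 * (d + t) * x + 2 * x) ≡ 2 * (d + suc t) * (l * x)
      regroup = solve-∀

  -- The lists A i belong to vertices chosen earlier; each new vertex shrinks
  -- them, and the lists of the remaining candidates, by a factor of at most ℓ.
  -- A new vertex must not ruin the lists of later candidates: each list is
  -- cramped by few vertices, so, on average, a vertex cramps few lists.
  independent-mids :
    ∀ t {s d} e → s + t ≤ d →
    (A : Fin s → List V) → (∀ i → Unique (A i)) →
    (∀ i → ℓ ^ suc (t + e) ≤ length (A i)) →
    (L : V → List V) → (∀ x → Unique (L x)) →
    ∀ M → Unique M → (∀ {x} → x ∈ M → ℓ ^ (t + e) ≤ length (L x)) →
    2 * (d + t) * ℓ ^ suc t ≤ length M →
    ∃ λ (m : Fin t → V) → (∀ j → m j ∈ M) × (∀ i j → ¬ m i ~ m j) ×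
      (∀ i → AtLeast (ℓ ^ suc e) λ a → a ∈ A i × ∀ j → ¬ m j ~ a) ×
      (∀ i → AtLeast (ℓ ^ suc e) λ a → a ∈ L (m i) × ∀ j → j ≢ i → ¬ m j ~ a)
  independent-mids zero e _ A A-unique A-large L _ M _ _ _ =
    (λ ()) , (λ ()) , (λ ()) ,
    (λ i → A i , A-unique i , A-large i , All.tabulate λ a∈ → a∈ , λ ()) ,
    λ ()
  independent-mids (suc t) {s} {d} e st≤d A A-unique A-large L L-unique M M-unique L-large M-large
    = step (count<length⇒∃¬ bad? M (≤-<-trans few-bad′ (few-bad st≤d M-large popular-half)))
    where
    k = ℓ ^ (t + e)
    -- What the recursive call demands of the candidates, plus an allowance for the spoiled ones.
    y = 2 * (d + t) * ℓ ^ suc t + 2 * ℓ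

    spoils? : ∀ x b → Dec (Cramped (L x) k b)
    spoils? x b = cramped? (L x) k b

    popular? : ∀ b → Dec (2 * ℓ ≤ count (λ x → spoils? x b) M)
    popular? b = 2 * ℓ ≤? count (λ x → spoils? x b) M

    crampsA? : ∀ b → Dec (∃ λ i → Cramped (A i) (ℓ * k) b)
    crampsA? b = any? λ i → cramped? (A i) (ℓ * k) b

    bad? = λ b → crampsA? b ⊎-dec (cramped? M y b ⊎-dec popular? b)

    popular-half : 2 * count popular? M ≤ length M
    -- Each candidate's list is spoiled by at most `pred ℓ` members of `M`, so at most half of `M`
    -- can spoil `2 * ℓ` lists or more.
    popular-half = few-popular spoils? ℓ M (All.tabulate λ x∈M →
      ≤-trans (few-cramped (L-unique _) M-unique (L-large x∈M)) pred[n]≤n)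

    M-large′ : ℓ * y ≤ length M
    M-large′ = ≤-trans (next-size d t) M-large

    few-bad′ : count bad? M ≤ s * r + (r + count popular? M)
    few-bad′ = ≤-trans
      (count-cover bad? crampsA? (λ b → cramped? M y b ⊎-dec popular? b) id M)
      (+-mono-≤
        (count-any s (λ i → cramped? (A i) (ℓ * k)) M λ i →
          few-cramped (A-unique i) M-unique (A-large i))
        (≤-trans (count-cover (λ b → cramped? M y b ⊎-dec popular? b) (cramped? M y) popular? id M)
          (+-monoˡ-≤ (count popular? M) (few-cramped M-unique M-unique M-large′))))

    M′ : V → List V
    M′ b = filter (λ x → ¬? (spoils? x b)) (M ∖N b)

    M′-large : ∀ {b} → ¬ Cramped M y b → ¬ 2 * ℓ ≤ count (λ x → spoils? x b) M →
               2 * (d + t) * ℓ ^ suc t ≤ length (M′ b)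
    M′-large {b} roomy unpopular = +-cancelˡ-≤ (2 * ℓ) _ _ (begin
      2 * ℓ + 2 * (d + t) * ℓ ^ suc t              ≡⟨ +-comm (2 * ℓ) _ ⟩
      y                                            ≤⟨ ≮⇒≥ roomy ⟩
      length (M ∖N b)                              ≡⟨ count-split (λ x → spoils? x b) (M ∖N b) ⟨
      count (λ x → spoils? x b) (M ∖N b) + length (M′ b)
        ≤⟨ +-monoˡ-≤ _ (count-filter-≤ (λ x → spoils? x b) _ M) ⟩
      count (λ x → spoils? x b) M + length (M′ b)  ≤⟨ +-monoˡ-≤ _ (<⇒≤ (≰⇒> unpopular)) ⟩
      2 * ℓ + length (M′ b)                        ∎)
      where open ≤-Reasoning

    step : (∃ λ b → b ∈ M ×
             ¬ ((∃ λ i → Cramped (A i) (ℓ * k) b) ⊎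
                (Cramped M y b ⊎ 2 * ℓ ≤ count (λ x → spoils? x b) M))) → _
    step (b , b∈M , good)
      with m , m∈ , indep , A⁺ , L⁺ ← independent-mids t {suc s} {d} e
             (≤-trans (≤-reflexive (sym (+-suc s t))) st≤d)
             -- The list of `b` keeps the neighbours of `b`, since its leaf must be one. Having
             -- skipped this round's shrinking, it is one factor `ℓ` longer than the remaining
             -- candidates' lists need be, just as the lists `A` require.
             (λ { zero → L b ; (suc i) → A i ∖N b })
             (λ { zero → L-unique b ; (suc i) → Unique.filter⁺ _ (A-unique i) })
             (λ { zero → L-large b∈M ; (suc i) → ≮⇒≥ λ c → good (inj₁ (i , c)) })
             (λ x → L x ∖N b) (λ x → Unique.filter⁺ _ (L-unique x))
             (M′ b) (Unique.filter⁺ _ (Unique.filter⁺ _ M-unique))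
             (λ x∈ → ≮⇒≥ (proj₂ (∈-filter⁻ (λ x → ¬? (spoils? x b)) {xs = M ∖N b} x∈)))
             (M′-large (good ∘ inj₂ ∘ inj₁) (good ∘ inj₂ ∘ inj₂))
      = (λ { zero → b ; (suc j) → m j })
      , (λ { zero → b∈M ; (suc j) → proj₁ (m∈M∖N j) })
      , (λ { zero    zero    → ~-irr
           ; zero    (suc j) → proj₂ (m∈M∖N j)
           ; (suc i) zero    → proj₂ (m∈M∖N i) ∘ ~-sym
           ; (suc i) (suc j) → indep i j })
      , (λ i → weaken (λ (a∈ , m≁a) → let a∈A , b≁a = ∈-filter⁻ _ a∈ in
           a∈A , λ { zero → b≁a ; (suc j) → m≁a j }) (A⁺ (suc i)))
      , λ { zero → weaken (λ (a∈ , m≁a) →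
              a∈ , λ { zero 0≢0 → contradiction refl 0≢0 ; (suc j) _ → m≁a j }) (A⁺ zero)
          ; (suc i) → weaken (λ (a∈ , m≁a) → let a∈L , b≁a = ∈-filter⁻ _ a∈ in
              a∈L , λ { zero _ → b≁a ; (suc j) j≢i → m≁a j (j≢i ∘ cong suc) }) (L⁺ i) }
      where
      m∈M∖N : ∀ j → m j ∈ M × ¬ b ~ m j
      m∈M∖N j = ∈-filter⁻ (λ a → ¬? (b ~? a))
        (proj₁ (∈-filter⁻ (λ x → ¬? (spoils? x b)) {xs = M ∖N b} (m∈ j)))

  -- Assembling the star.

  InducedCopy : {W : Set} → Graph W → Set
  InducedCopy {W} H = ∃ λ (f : W → V) → ∀ u w → (f u ~ f w) ⇔ Graph._~_ H u w

  induced-star : ∀ e {v} {m l : Fin e → V} →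
    (∀ i → v ~ m i) → (∀ i j → ¬ m i ~ m j) → (∀ i → m i ~ l i) →
    (∀ i j → j ≢ i → ¬ m j ~ l i) → (∀ i → ¬ v ~ l i) → (∀ i j → ¬ l i ~ l j) →
    InducedCopy (subdividedStar e)
  induced-star e {v} {m} {l} v~m m≁m m~l m≁l v≁l l≁l = f , exact
    where
    f : StarVertex e → V
    f centre   = v
    f (mid i)  = m i
    f (leaf i) = l i

    m~l⇒≡ : ∀ i j → m i ~ l j → i ≡ j
    m~l⇒≡ i j edge = decidable-stable (i ≟ᶠ j) λ i≢j → m≁l j i i≢j edge

    exact : ∀ u w → (f u ~ f w) ⇔ Graph._~_ (subdividedStar e) u w
    exact centre   centre   = mk⇔ ~-irr λ ()
    exact centre   (mid j)  = mk⇔ (λ _ → tt) (λ _ → v~m j)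
    exact centre   (leaf j) = mk⇔ (v≁l j) λ ()
    exact (mid i)  centre   = mk⇔ (λ _ → tt) (λ _ → ~-sym (v~m i))
    exact (mid i)  (mid j)  = mk⇔ (m≁m i j) λ ()
    exact (mid i)  (leaf j) = mk⇔ (m~l⇒≡ i j) λ { refl → m~l i }
    exact (leaf i) centre   = mk⇔ (v≁l i ∘ ~-sym) λ ()
    exact (leaf i) (mid j)  = mk⇔ (sym ∘ m~l⇒≡ j i ∘ ~-sym) λ { refl → ~-sym (m~l i) }
    exact (leaf i) (leaf j) = mk⇔ (l≁l i j) λ ()

  -- The lists already exclude every unwanted edge at a leaf except those between two leaves, and
  -- `transversal` excludes these.
  star-from-mids : ∀ {p v} {m : Fin (suc p) → V} →
    (∀ i → v ~ m i) → (∀ i j → ¬ m i ~ m j) →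
    (∀ i → AtLeast (ℓ ^ p) λ a → m i ~ a × ¬ v ~ a × ∀ j → j ≢ i → ¬ m j ~ a) →
    InducedCopy (subdividedStar (suc p))
  star-from-mids {p} {v} {m} v~m m≁m B
    with l , l∈ , l≁l ← transversal p (proj₁ ∘ B)
           (λ i → proj₁ (proj₂ (B i))) (λ i → proj₁ (proj₂ (proj₂ (B i))))
    = induced-star (suc p) v~m m≁m
        (λ i → proj₁ (good i)) (λ i → proj₂ (proj₂ (good i))) (λ i → proj₁ (proj₂ (good i)))
        l≁l
    where
    good : ∀ i → m i ~ l i × ¬ v ~ l i × ∀ j → j ≢ i → ¬ m j ~ l i
    good i = All.lookup (proj₂ (proj₂ (proj₂ (B i)))) (l∈ i)

  -- Vertices of minimum degree.

  module _ {E : List V} (E-unique : Unique E) where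

    private
      N : V → List V
      N u = filter (u ~?_) E

      N-unique : ∀ u → Unique (N u)
      N-unique u = Unique.filter⁺ (u ~?_) E-unique

    -- The common neighbours cancel. For `u` of minimum degree, this converts nonneighbours of `w`
    -- inside the neighbourhood of `u` into neighbours of `w` outside it.
    private-neighbours : ∀ {u w} → length (N u) ≤ length (N w) →
                         length (N u ∖N w) ≤ length (N w ∖N u)
    private-neighbours {u} {w} le = +-cancelˡ-≤ (count (w ~?_) (N u)) _ _ (begin
      count (w ~?_) (N u) + length (N u ∖N w)  ≡⟨ count-split (w ~?_) (N u) ⟩
      length (N u)                             ≤⟨ le ⟩
      length (N w)                             ≡⟨ count-split (u ~?_) (N w) ⟨
      count (u ~?_) (N w) + length (N w ∖N u)  ≡⟨ cong (_+ length (N w ∖N u)) (count-filter-comm (u ~?_) (w ~?_) E) ⟩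
      count (w ~?_) (N u) + length (N w ∖N u)  ∎)
      where open ≤-Reasoning

    private
      roomy? : ∀ v k x → Dec (¬ Cramped (N v) k x)
      roomy? v k x = ¬? (cramped? (N v) k x)

    many-roomy : ∀ {k N₀} v → ℓ * k ≤ length (N v) → N₀ + r ≤ length (N v) →
                 N₀ ≤ count (roomy? v k) (N v)
    many-roomy {k} {N₀} v large large′ = +-cancelˡ-≤ r _ _ (begin
      r + N₀                                       ≡⟨ +-comm r N₀ ⟩
      N₀ + r                                       ≤⟨ large′ ⟩
      length (N v)                                 ≡⟨ count-split (cramped? (N v) k) (N v) ⟨
      count (cramped? (N v) k) (N v) + count (roomy? v k) (N v)
        ≤⟨ +-monoˡ-≤ _ (few-cramped (N-unique v) (N-unique v) large) ⟩
      r + count (roomy? v k) (N v)                 ∎)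
      where open ≤-Reasoning

    mids-at-minimum-degree : ∀ d e v →
      (∀ {u} → u ∈ E → length (N v) ≤ length (N u)) →
      ℓ ^ suc (d + e) ≤ length (N v) →
      2 * (d + d) * ℓ ^ suc d + r ≤ length (N v) →
      ∃ λ (m : Fin d → V) → (∀ i → v ~ m i) × (∀ i j → ¬ m i ~ m j) ×
        (∀ i → AtLeast (ℓ ^ suc e) λ a → m i ~ a × ¬ v ~ a × ∀ j → j ≢ i → ¬ m j ~ a)
    mids-at-minimum-degree d e v minimal large large′
      -- At the start no vertex has been chosen, so there are no lists `A`. The candidates are the
      -- neighbours of `v` that are not cramped, and minimality of `v` makes their lists long.
      with m , m∈ , m≁m , _ , B ← independent-mids d {0} {d} e ≤-refl
             (λ ()) (λ ()) (λ ())
             (λ x → N x ∖N v) (λ x → Unique.filter⁺ _ (N-unique x))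
             (filter (roomy? v (ℓ ^ (d + e))) (N v)) (Unique.filter⁺ _ (N-unique v))
             (λ x∈M → let x∈N , roomy = ∈-filter⁻ (roomy? v (ℓ ^ (d + e))) x∈M in
               ≤-trans (≮⇒≥ roomy) (private-neighbours (minimal (proj₁ (∈-filter⁻ (v ~?_) x∈N)))))
             (many-roomy {ℓ ^ (d + e)} v large large′)
      = m
      , (λ i → proj₂ (∈-filter⁻ (v ~?_) {xs = E} (proj₁ (∈-filter⁻ (roomy? v (ℓ ^ (d + e))) (m∈ i)))))
      , m≁m
      , λ i → weaken (λ {a} (a∈ , m≁a) →
          let a∈N , v≁a = ∈-filter⁻ (λ x → ¬? (v ~? x)) {xs = N (m i)} a∈
          in proj₂ (∈-filter⁻ (m i ~?_) {xs = E} a∈N) , v≁a , m≁a) (B i)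

    -- With `d = 2 + e`, the lists that survive the choice of the middle vertices have size
    -- `ℓ ^ suc e`, which is what `transversal` needs for `d` lists.
    star-at-minimum-degree : ∀ e v → let d = 2 + e in
      (∀ {u} → u ∈ E → length (N v) ≤ length (N u)) →
      ℓ ^ suc (d + e) ≤ length (N v) →
      2 * (d + d) * ℓ ^ suc d + r ≤ length (N v) →
      InducedCopy (subdividedStar d)
    star-at-minimum-degree e v minimal large large′ =
      let m , v~m , m≁m , B = mids-at-minimum-degree (2 + e) e v minimal large large′
      in star-from-mids v~m m≁m B

-- From adjacency-exact maps to induced subgraphs.

-- Twin-freeness makes every adjacency-exact map from the star injective, so the
-- construction need not keep its vertices distinct.  For d = 1 the star is P₃,
-- whose two ends are twins.
star-twin-free : ∀ e → let open Graph (subdividedStar (2 + e)) in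
  ∀ u w → (∀ x → x ~ u → x ~ w) → (∀ x → x ~ w → x ~ u) → u ≡ w
star-twin-free e centre   centre   _  _  = refl
star-twin-free e centre   (mid j)  _  wu = contradiction (wu centre tt) λ ()
star-twin-free e centre   (leaf j) uw _  =
  contradiction (trans (uw (mid zero) tt) (sym (uw (mid (suc zero)) tt))) λ ()
star-twin-free e (mid i)  centre   uw _  = contradiction (uw centre tt) λ ()
star-twin-free e (mid i)  (mid j)  uw _  = cong mid (uw (leaf i) refl)
star-twin-free e (mid i)  (leaf j) uw _  = contradiction (uw centre tt) λ ()
star-twin-free e (leaf i) centre   _  wu =
  contradiction (trans (wu (mid zero) tt) (sym (wu (mid (suc zero)) tt))) λ ()
star-twin-free e (leaf i) (mid j)  _  wu = contradiction (wu centre tt) λ ()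
star-twin-free e (leaf i) (leaf j) uw _  = cong leaf (uw (mid i) refl)

starVertex? : ∀ {d} {P : Pred (StarVertex d) 0ℓ} → Decidable P → Dec (∃ P)
starVertex? P? = map′
  (λ { (inj₁ p) → centre , p
     ; (inj₂ (inj₁ (i , p))) → mid i , p
     ; (inj₂ (inj₂ (i , p))) → leaf i , p })
  (λ { (centre , p) → inj₁ p
     ; (mid i , p) → inj₂ (inj₁ (i , p))
     ; (leaf i , p) → inj₂ (inj₂ (i , p)) })
  (P? centre ⊎-dec (any? (P? ∘ mid) ⊎-dec any? (P? ∘ leaf)))

module _ {n : ℕ} where

  subset : {P : Pred (Fin n) 0ℓ} → Decidable P → Subset n
  subset P? = tabulate (does ∘ P?)

  ∈-subset⁺ : {P : Pred (Fin n) 0ℓ} (P? : Decidable P) → ∀ {v} → P v → v Subset.∈ subset P?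
  ∈-subset⁺ P? {v} p = lookup⇒[]= v _ (trans (lookup∘tabulate (does ∘ P?) v) (dec-true (P? v) p))

  ∈-subset⁻ : {P : Pred (Fin n) 0ℓ} (P? : Decidable P) → ∀ {v} → v Subset.∈ subset P? → P v
  ∈-subset⁻ P? {v} v∈ with P? v | trans (sym (lookup∘tabulate (does ∘ P?) v)) ([]=⇒lookup v∈)
  ... | yes p | _ = p

[]=-irrelevant : ∀ {n} {x : A} {xs : Vec A n} {i} (p q : xs Vec.[ i ]= x) → p ≡ q
[]=-irrelevant Vec.here      Vec.here      = refl
[]=-irrelevant (Vec.there p) (Vec.there q) = cong Vec.there ([]=-irrelevant p q)

-- The set is the image of `f`; `image?` makes it a `Subset` and yields the preimages that form the
-- inverse of `f`.
embedding⇒induced : ∀ {n} {W : Set} {G : Graph (Fin n)} {H : Graph W} (f : W → Fin n) →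
  Injective _≡_ _≡_ f → (∀ v → Dec (∃ λ w → f w ≡ v)) →
  (∀ u w → Graph._~_ G (f u) (f w) ⇔ Graph._~_ H u w) →
  ∃ λ S → induced G S ≅ H
embedding⇒induced {G = G} {H} f injective image? exact = S , record
  { bijection = mk↔ₛ′ (λ (v , v∈S) → proj₁ (preimage v∈S)) (λ w → f w , f∈S w)
      (λ w → injective (proj₂ (preimage (f∈S w))))
      (λ (v , v∈S) → pair-≡ (proj₂ (preimage v∈S)))
  ; preserves = λ (u , u∈S) (w , w∈S) →
      subst₂ (λ x y → Graph._~_ G x y ⇔ Graph._~_ H (proj₁ (preimage u∈S)) (proj₁ (preimage w∈S)))
        (proj₂ (preimage u∈S)) (proj₂ (preimage w∈S)) (exact _ _)
  }
  where
  S = subset image?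
  preimage : ∀ {v} → v Subset.∈ S → ∃ λ w → f w ≡ v
  preimage = ∈-subset⁻ image?
  f∈S : ∀ w → f w Subset.∈ S
  f∈S w = ∈-subset⁺ image? (w , refl)
  pair-≡ : ∀ {u v} {u∈S : u Subset.∈ S} {v∈S : v Subset.∈ S} → u ≡ v →
           _≡_ {A = ∃ λ v → v Subset.∈ S} (u , u∈S) (v , v∈S)
  pair-≡ refl = cong (_ ,_) ([]=-irrelevant _ _)

-- Subsets as lists of vertices.

elements : ∀ {n} → Subset n → List (Fin n)
elements Vec.[]            = []
elements (inside  Vec.∷ S) = zero ∷ map suc (elements S)
elements (outside Vec.∷ S) = map suc (elements S)

∈-elements⁺ : ∀ {n} {S : Subset n} {v} → v Subset.∈ S → v ∈ elements S
∈-elements⁺ Vec.here = here refl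
∈-elements⁺ {S = inside  Vec.∷ _} (Vec.there v∈) = there (∈-map⁺ suc (∈-elements⁺ v∈))
∈-elements⁺ {S = outside Vec.∷ _} (Vec.there v∈) = ∈-map⁺ suc (∈-elements⁺ v∈)

∈-elements⁻ : ∀ {n} (S : Subset n) {v} → v ∈ elements S → v Subset.∈ S
∈-elements⁻ (inside  Vec.∷ S) (here refl) = Vec.here
∈-elements⁻ (inside  Vec.∷ S) (there v∈)
  with _ , w∈ , refl ← ∈-map⁻ suc v∈ = Vec.there (∈-elements⁻ S w∈)
∈-elements⁻ (outside Vec.∷ S) v∈
  with _ , w∈ , refl ← ∈-map⁻ suc v∈ = Vec.there (∈-elements⁻ S w∈)

elements-unique : ∀ {n} (S : Subset n) → Unique (elements S)
elements-unique Vec.[]            = []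
elements-unique (inside  Vec.∷ S) =
  All-map⁺ (All.universal (λ _ ()) _) ∷ Unique.map⁺ suc-injectiveᶠ (elements-unique S)
elements-unique (outside Vec.∷ S) = Unique.map⁺ suc-injectiveᶠ (elements-unique S)

count-map : {P : Pred B 0ℓ} (P? : Decidable P) (f : A → B) (xs : List A) →
            count P? (map f xs) ≡ count (P? ∘ f) xs
count-map P? f []       = refl
count-map P? f (x ∷ xs) with ih ← count-map P? f xs | does (P? (f x))
... | true  = cong suc ih
... | false = ih

-- For adjacency to `u`, the set `subset P?` is `neighbours G u` by definition, so this translates
-- `degreeIn` into a list count.
count-elements : ∀ {n} {P : Pred (Fin n) 0ℓ} (P? : Decidable P) (S : Subset n) →
                 count P? (elements S) ≡ ∣ subset P? ∩ S ∣
count-elements P? Vec.[] = refl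
count-elements P? (outside Vec.∷ S)
  with ih ← trans (count-map P? suc (elements S)) (count-elements (P? ∘ suc) S) | does (P? zero)
... | true  = ih
... | false = ih
count-elements P? (inside Vec.∷ S)
  with ih ← trans (count-map P? suc (elements S)) (count-elements (P? ∘ suc) S) | does (P? zero)
... | true  = cong suc ih
... | false = ih

-- The degeneracy bound.

minimum-degree-vertex : ∀ {n} (G : Graph (Fin n)) (S : Subset n) → Subset.Nonempty S →
  ∃ λ v → v Subset.∈ S × ∀ {u} → u Subset.∈ S → degreeIn G S v ≤ degreeIn G S u
minimum-degree-vertex G S (w , w∈S) = v , v∈S , λ u∈S →
  All.lookup (f[argmin]≤f[xs] w (elements S)) (∈-elements⁺ u∈S)
  where
  v = argmin (degreeIn G S) w (elements S)
  v∈S : v Subset.∈ S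
  v∈S with argmin-sel (degreeIn G S) w (elements S)
  ... | inj₁ v≡w = subst (Subset._∈ S) (sym v≡w) w∈S
  ... | inj₂ v∈  = ∈-elements⁻ S v∈

-- A vertex of minimum degree in `S` is the witness: if its degree exceeded the bound, it would be
-- the centre of an induced star.
degenerate : ∀ e {ℓ} → 2 ≤ ℓ → ∀ {n} (G : Graph (Fin n)) →
             subdividedStar (2 + e) -Free G →
             ¬ (G ContainsSubgraph completeBipartite ℓ ℓ) →
             Degenerate G (9 * ℓ ^ suc (2 + e + e))
degenerate e {ℓ} 2≤ℓ G star-free K-free S nonempty =
  let v , v∈S , minimal = minimum-degree-vertex G S nonempty
  in v , v∈S , ≮⇒≥ λ lt → star-free (induced-copy (star v minimal (<⇒≤ lt)))
  where
  open Graph G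
  instance
    ℓ≢0 : NonZero ℓ
    ℓ≢0 = >-nonZero (<⇒≤ 2≤ℓ)
  open BicliqueFree G ℓ K-free

  degree : ∀ u → degreeIn G S u ≡ count (u ~?_) (elements S)
  degree u = sym (count-elements (u ~?_) S)

  star : ∀ v → (∀ {u} → u Subset.∈ S → degreeIn G S v ≤ degreeIn G S u) →
         9 * ℓ ^ suc (2 + e + e) ≤ degreeIn G S v → InducedCopy (subdividedStar (2 + e))
  star v minimal large = star-at-minimum-degree (elements-unique S) e v
    (λ {u} u∈ → subst₂ _≤_ (degree v) (degree u) (minimal (∈-elements⁻ S u∈)))
    -- One of the nine copies is enough for the length of the lists; the number of candidates takes
    -- all nine.
    (≤-trans (m≤m+n (ℓ ^ suc (2 + e + e)) _) large′)
    (≤-trans (degree-bound 2≤ℓ e) large′)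
    where
    large′ : 9 * ℓ ^ suc (2 + e + e) ≤ count (v ~?_) (elements S)
    large′ = subst (9 * ℓ ^ suc (2 + e + e) ≤_) (degree v) large

  induced-copy : InducedCopy (subdividedStar (2 + e)) → ∃ λ S → induced G S ≅ subdividedStar (2 + e)
  induced-copy (f , exact) =
    embedding⇒induced f injective (λ v → starVertex? (λ w → f w ≟ᶠ v)) exact
    where
    module H = Graph (subdividedStar (2 + e))
    -- Adjacency in the star is read off from the images, so vertices with equal images are twins.
    twin : ∀ {u w} → f u ≡ f w → ∀ x → x H.~ u → x H.~ w
    twin {u} {w} eq x x~u = Equivalence.to (exact x w)
      (subst (f x ~_) eq (Equivalence.from (exact x u) x~u))
    injective : Injective _≡_ _≡_ f
    injective {u} {w} fu≡fw = star-twin-free e u w (twin fu≡fw) (twin (sym fu≡fw))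

theorem3 : ∃ λ (C : ℕ) → 0 < C ×
    (∀ (d ℓ : ℕ) → 2 ≤ d → 2 ≤ ℓ →
    ∀ {n : ℕ} (G : Graph (Fin n)) →
    subdividedStar d -Free G →
    ¬ (G ContainsSubgraph completeBipartite ℓ ℓ) →
    degeneracy G ≤ C * ℓ ^ (2 * d ∸ 1))
theorem3 = 9 , z<s , λ { (suc (suc e)) ℓ (s≤s (s≤s z≤n)) 2≤ℓ G star-free K-free →
  proj₂ (proj₂ (minimumDegenerate G)) _
    (subst (λ k → Degenerate G (9 * ℓ ^ k)) (cong pred (exponent e))
      (degenerate e 2≤ℓ G star-free K-free)) }
  where
  -- Stated one above the actual exponents to stay clear of truncated subtraction; `pred` brings
  -- both sides down.
  exponent : ∀ e → suc (suc (2 + e + e)) ≡ 2 * (2 + e)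
  exponent = solve-∀
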